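{- The class $R(\mathrm{D},\mathrm{R},*)$ of representable $\{\mathrm{D},\mathrm{R},*\}$-structures cannot be axiomatised by a finite first-order theory.
   Context: For a set $X$ and relations $R,S\subseteq X\times X$ define: domain $\mathrm{D}(R)=\{(x,x)\mid \exists y\,(x,y)\in R\}$; range $\mathrm{R}(R)=\{(y,y)\mid \exists x\,(x,y)\in R\}$; ordinary composition $R;S=\{(x,z)\mid \exists y\,((x,y)\in R\wedge (y,z)\in S)\}$; demonic composition $R*S=\{(x,y)\in R;S\mid \forall z\,((x,z)\in R\Rightarrow (z,z)\in \mathrm{D}(S))\}$. A $\{\mathrm{D},\mathrm{R},*\}$-structure is a set with two unary operations $\mathrm{D},\mathrm{R}$ and a binary operation $*$. It is proper if its underlying set is a set of binary relations on some base set $X$ (i.e. a subset of $\wp(X\times X)$) closed under these operations, with $\mathrm{D},\mathrm{R},*$ interpreted as domain, range and demonic composition above. The representation class $R(\mathrm{D},\mathrm{R},*)$ is the class of all $\{\mathrm{D},\mathrm{R},*\}$-structures isomorphic to a proper one. -}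

module Defs where

open import Level using (Level; 0ℓ)
open import Data.Nat using (ℕ; suc)
open import Data.Fin using (Fin; zero; suc)
open import Data.Empty using (⊥)
open import Data.Product using (Σ; _×_; _,_; ∃)
open import Data.Sum using (_⊎_)
open import Data.List using (List)
open import Data.List.Relation.Unary.All using (All)
open import Relation.Binary.PropositionalEquality using (_≡_)
open import Function.Bundles using (_⇔_)

record DRStar : Set₁ where
  field
    Carrier : Set
    D R     : Carrier → Carrier
    _*_     : Carrier → Carrier → Carrier

Rel₂ : Set → Set₁
Rel₂ X = X → X → Set

module _ {X : Set} where

  dom : Rel₂ X → Rel₂ X
  dom r x x′ = (x ≡ x′) × ∃ λ y → r x y

  ran : Rel₂ X → Rel₂ X
  ran r y y′ = (y ≡ y′) × ∃ λ x → r x y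

  comp : Rel₂ X → Rel₂ X → Rel₂ X
  comp r s x z = ∃ λ y → r x y × s y z

  demonic : Rel₂ X → Rel₂ X → Rel₂ X
  demonic r s x y = comp r s x y × (∀ z → r x z → dom s z z)

  _≐_ : Rel₂ X → Rel₂ X → Set
  r ≐ s = ∀ x y → r x y ⇔ s x y

-- Representability: isomorphic to a proper structure, i.e. there is a
-- base set X and an injective map θ into the relations on X sending
-- D, R, * to domain, range and demonic composition (the image of θ is
-- then a proper structure isomorphic to A).

record Representation (A : DRStar) : Set₁ where
  open DRStar A
  field
    Base   : Set
    θ      : Carrier → Rel₂ Base
    inj    : ∀ a b → θ a ≐ θ b → a ≡ b
    pres-D : ∀ a → θ (D a) ≐ dom (θ a)
    pres-R : ∀ a → θ (R a) ≐ ran (θ a)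
    pres-* : ∀ a b → θ (a * b) ≐ demonic (θ a) (θ b)

Representable : DRStar → Set₁
Representable A = Representation A

data Term (n : ℕ) : Set where
  var  : Fin n → Term n
  D̂ R̂  : Term n → Term n
  _*̂_  : Term n → Term n → Term n

data Formula : ℕ → Set where
  _≈̂_       : ∀ {n} → Term n → Term n → Formula n
  ⊥̂         : ∀ {n} → Formula n
  ¬̂_        : ∀ {n} → Formula n → Formula n
  _∧̂_ _∨̂_ _⇒̂_ : ∀ {n} → Formula n → Formula n → Formula n
  ∀̂ ∃̂       : ∀ {n} → Formula (suc n) → Formula n

Sentence : Set
Sentence = Formula 0

extend : ∀ {n} {C : Set} → C → (Fin n → C) → Fin (suc n) → C
extend c ρ zero    = c
extend c ρ (suc i) = ρ i

module _ (A : DRStar) where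
  open DRStar A

  ⟦_⟧ₜ : ∀ {n} → Term n → (Fin n → Carrier) → Carrier
  ⟦ var i ⟧ₜ ρ   = ρ i
  ⟦ D̂ t ⟧ₜ ρ     = D (⟦ t ⟧ₜ ρ)
  ⟦ R̂ t ⟧ₜ ρ     = R (⟦ t ⟧ₜ ρ)
  ⟦ t *̂ u ⟧ₜ ρ   = ⟦ t ⟧ₜ ρ * ⟦ u ⟧ₜ ρ

  Sat : ∀ {n} → Formula n → (Fin n → Carrier) → Set
  Sat (t ≈̂ u) ρ = ⟦ t ⟧ₜ ρ ≡ ⟦ u ⟧ₜ ρ
  Sat ⊥̂ ρ       = ⊥
  Sat (¬̂ φ) ρ   = Sat φ ρ → ⊥
  Sat (φ ∧̂ ψ) ρ = Sat φ ρ × Sat ψ ρ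
  Sat (φ ∨̂ ψ) ρ = Sat φ ρ ⊎ Sat ψ ρ
  Sat (φ ⇒̂ ψ) ρ = Sat φ ρ → Sat ψ ρ
  Sat (∀̂ φ) ρ   = ∀ a → Sat φ (extend a ρ)
  Sat (∃̂ φ) ρ   = Σ Carrier λ a → Sat φ (extend a ρ)

  _⊨_ : Sentence → Set
  _⊨_ σ = Sat σ (λ ())

  ModelOf : List Sentence → Set
  ModelOf T = All _⊨_ T

Axiomatises : List Sentence → Set₁
Axiomatises T = ∀ (A : DRStar) → (Representable A → ModelOf A T) × (ModelOf A T → Representable A)

{-# OPTIONS --safe #-}
module Submission where

open import Defs
import Data.Integer.Properties as ℤ
open import Algebra.Properties.AbelianGroup ℤ.+-0-abelianGroup using (∙-cancelʳ)
open import Data.Bool using (Bool; true; false)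
open import Data.Empty using (⊥-elim)
open import Data.Fin using (Fin; zero; suc; toℕ; fromℕ<)
import Data.Fin.Properties as Fin
open import Data.Integer as ℤ using (ℤ; +_; 1ℤ; ∣_∣)
open import Data.List using (List; []; _∷_)
open import Data.List.Relation.Unary.All using ([]; _∷_)
open import Data.Nat using (ℕ; zero; suc; _+_; _*_; _∸_; _≤_; _<_; z≤n; s≤s)
open import Data.Nat.DivMod
  using (_%_; _/_; m%n<n; m<n⇒m%n≡m; [m+n]%n≡m%n; m≡m%n+[m/n]*n; %-distribˡ-+; m%n%n≡m%n)
open import Data.Nat.GeneralisedArithmetic using (fold; fold-+)
import Data.Nat.Properties as ℕ
open import Data.Product using (Σ; ∃; _×_; _,_; proj₁; proj₂)
open import Data.Product.Properties using (≡-dec)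
open import Data.Sum using (inj₁; inj₂)
open import Function.Properties.Equivalence using () renaming (sym to ⇔-sym; trans to ⇔-trans)
open import Function using (id; _∘_; mk⇔; Equivalence; _⇔_)
open import Relation.Binary.Definitions using (DecidableEquality)
open import Relation.Binary.PropositionalEquality
  using (_≡_; _≢_; refl; sym; trans; cong; subst; module ≡-Reasoning)
open import Relation.Nullary using (¬_; Dec; yes; no; contradiction)
open import Relation.Nullary.Decidable using (map′)

open Equivalence using (to; from)

-- To a chain, a set I with a bijection S, attach a category with objects X, Y, Z i, W i and arrows
--
--     p i : X → Z i,   q i : Z i → Y,   e i : Z i → W i,   g i : W i → Z i,   g i ⨾ e i = id,
--     a i = p i ⨾ q i,   a (S i) = p i ⨾ e i ⨾ g i ⨾ q i,
--
-- and turn it into a structure by adding a zero for undefined composites, with D and R the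
-- identities at source and target.  In any representation g i ⨾ e i = id makes e i ⨾ g i reflexive,
-- whence a i ⊆ a (S i).  So the structure of a nontrivial finite cycle is not representable, while
-- that of ℤ is: let a i be the relation y ≤ x + i.  Sentences of bounded quantifier depth cannot
-- distinguish ℤ from copies of a long cycle, by an Ehrenfeucht–Fraïssé game in which the distance
-- up to which the two positions agree is halved at each move.

-- Categories with an adjoined zero, and their representation by functors.

module ZeroAdjoined
  (Obj : Set) (_≟_ : DecidableEquality Obj)
  (Hom : Obj → Obj → Set)
  (ι : ∀ {A} → Hom A A)
  (_⨾_ : ∀ {A B C} → Hom A B → Hom B C → Hom A C)
  where

  data El : Set where
    ∅   : El
    mor : ∀ {A B} → Hom A B → El

  -- The decision is an argument so that `Els-paste` can analyse the decisions of two structures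
  -- side by side.
  paste : ∀ {A B C E} → Dec (B ≡ C) → Hom A B → Hom C E → El
  paste (yes refl) f h = mor (f ⨾ h)
  paste (no _)     f h = ∅

  dm rn : El → El
  dm ∅             = ∅
  dm (mor {A} f)   = mor (ι {A})
  rn ∅             = ∅
  rn (mor {_} {B} f) = mor (ι {B})

  _·_ : El → El → El
  ∅     · _     = ∅
  mor f · ∅     = ∅
  mor {_} {B} f · mor {C} h = paste (B ≟ C) f h

  algebra : DRStar
  algebra = record { Carrier = El ; D = dm ; R = rn ; _*_ = _·_ }

  ·-composable : ∀ {A B C} (f : Hom A B) (h : Hom B C) → mor f · mor h ≡ mor (f ⨾ h)
  ·-composable {_} {B} f h with B ≟ B
  ... | yes refl = refl
  ... | no B≢B   = contradiction refl B≢B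

  -- Totality and surjectivity make the demonic side condition vacuous, so a
  -- faithful functor into total surjective relations represents the algebra.
  module Functor
    (Pt : Obj → Set)
    (⟪_⟫ : ∀ {A B} → Hom A B → Pt A → Pt B → Set)
    (⟪⟫-ι : ∀ {A} {x y : Pt A} → ⟪ ι ⟫ x y ⇔ (x ≡ y))
    (⟪⟫-⨾ : ∀ {A B C} (f : Hom A B) (h : Hom B C) {x z} →
            ⟪ f ⨾ h ⟫ x z ⇔ (∃ λ y → ⟪ f ⟫ x y × ⟪ h ⟫ y z))
    (total : ∀ {A B} (f : Hom A B) x → ∃ λ y → ⟪ f ⟫ x y)
    (surjective : ∀ {A B} (f : Hom A B) y → ∃ λ x → ⟪ f ⟫ x y)
    (point : ∀ A → Pt A)
    (faithful : ∀ {A B} (f h : Hom A B) → (∀ x y → ⟪ f ⟫ x y ⇔ ⟪ h ⟫ x y) → f ≡ h)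
    where

    data Θ : El → Rel₂ (Σ Obj Pt) where
      lift : ∀ {A B} {f : Hom A B} {x y} → ⟪ f ⟫ x y → Θ (mor f) (A , x) (B , y)

    lower : ∀ {A B} {f : Hom A B} {x y} → Θ (mor f) (A , x) (B , y) → ⟪ f ⟫ x y
    lower (lift r) = r

    -- By totality and `point` the relation of an arrow is nonempty, and any pair in it reveals
    -- source and target; only then can `faithful` compare two arrows.
    Θ-injective : ∀ a b → Θ a ≐ Θ b → a ≡ b
    Θ-injective ∅ ∅ _ = refl
    Θ-injective ∅ (mor {A} f) eq with from (eq _ _) (lift (proj₂ (total f (point A))))
    ... | ()
    Θ-injective (mor {A} f) ∅ eq with to (eq _ _) (lift (proj₂ (total f (point A))))
    ... | ()
    Θ-injective (mor {A} f) (mor h) eq with to (eq _ _) (lift (proj₂ (total f (point A))))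
    ... | lift _ = cong mor (faithful f h λ x y →
            mk⇔ (lower ∘ to (eq _ _) ∘ lift) (lower ∘ from (eq _ _) ∘ lift))

    Θ-D : ∀ a → Θ (dm a) ≐ dom (Θ a)
    Θ-D ∅       x y = mk⇔ (λ ()) λ { (_ , _ , ()) }
    Θ-D (mor f) x y = mk⇔
      (λ { (lift {x = u} r) → cong (_ ,_) (to ⟪⟫-ι r) , _ , lift (proj₂ (total f u)) })
      (λ { (refl , _ , lift _) → lift (from ⟪⟫-ι refl) })

    Θ-R : ∀ a → Θ (rn a) ≐ ran (Θ a)
    Θ-R ∅       x y = mk⇔ (λ ()) λ { (_ , _ , ()) }
    Θ-R (mor f) x y = mk⇔
      (λ { (lift {x = u} r) → cong (_ ,_) (to ⟪⟫-ι r) , _ , lift (proj₂ (surjective f u)) })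
      (λ { (refl , _ , lift _) → lift (from ⟪⟫-ι refl) })

    Θ-* : ∀ a b → Θ (a · b) ≐ demonic (Θ a) (Θ b)
    Θ-* ∅       b x y = mk⇔ (λ ()) λ { ((_ , () , _) , _) }
    Θ-* (mor f) ∅ x y = mk⇔ (λ ()) λ { ((_ , _ , ()) , _) }
    Θ-* (mor {_} {B} f) (mor {C} h) x y with B ≟ C
    ... | yes refl = mk⇔
          (λ { (lift r) → let _ , r₁ , r₂ = to (⟪⟫-⨾ f h) r in
               (_ , lift r₁ , lift r₂) ,
               λ { _ (lift {y = v} _) → refl , _ , lift (proj₂ (total h v)) } })
          (λ { ((_ , lift r₁ , lift r₂) , _) → lift (from (⟪⟫-⨾ f h) (_ , r₁ , r₂)) })
    ... | no B≢C = mk⇔ (λ ()) λ { ((_ , lift _ , lift _) , _) → contradiction refl B≢C }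

    representation : Representation algebra
    representation = record
      { Base = Σ Obj Pt ; θ = Θ ; inj = Θ-injective
      ; pres-D = Θ-D ; pres-R = Θ-R ; pres-* = Θ-* }

-- Chains and their orbits.

record Chain : Set₁ where
  field
    I      : Set
    _≟_    : DecidableEquality I
    S      : I → I
    S-inj  : ∀ {i j} → S i ≡ S j → i ≡ j
    S-surj : ∀ i → ∃ λ j → S j ≡ i
    -- Provides the answer to an element far from all earlier ones; at `M` = 0 it also yields an
    -- inhabitant of `I`.
    fresh  : ∀ M {m} (a : Fin m → I) →
             ∃ λ i → ∀ k {s t} → s ≤ M → t ≤ M → fold i S s ≢ fold (a k) S t

  S^-inj : ∀ n {i j} → fold i S n ≡ fold j S n → i ≡ j
  S^-inj zero    eq = eq
  S^-inj (suc n) eq = S^-inj n (S-inj eq)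

  S^-surj : ∀ n i → ∃ λ j → fold j S n ≡ i
  S^-surj zero    i = i , refl
  S^-surj (suc n) i = let j , Sj≡i = S-surj i
                          k , eq   = S^-surj n j
                      in k , trans (cong S eq) Sj≡i

  -- Apply `S`, which is injective, another `s` times: `s` steps past `i` are `t` steps past `c`.
  -- This replaces `i` by `c` in a comparison with `d`, at the price of larger offsets.
  shift-⇔ : ∀ {i c d s t} u v → fold i S s ≡ fold c S t →
            (fold i S u ≡ fold d S v) ⇔ (fold c S (u + t) ≡ fold d S (s + v))
  shift-⇔ {i} {c} {d} {s} {t} u v eq = mk⇔
    (λ h → trans (sym left) (trans (cong (λ j → fold j S s) h) (sym (fold-+ d S s))))
    (λ h → S^-inj s (trans left (trans h (fold-+ d S s))))
    where
    open ≡-Reasoning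
    left : fold (fold i S u) S s ≡ fold c S (u + t)
    left = begin
      fold (fold i S u) S s  ≡⟨ fold-+ i S s ⟨
      fold i S (s + u)       ≡⟨ cong (fold i S) (ℕ.+-comm s u) ⟩
      fold i S (u + s)       ≡⟨ fold-+ i S u ⟩
      fold (fold i S s) S u  ≡⟨ cong (λ j → fold j S u) eq ⟩
      fold (fold c S t) S u  ≡⟨ fold-+ c S u ⟨
      fold c S (u + t)       ∎

  -- Bounded, since a cycle has this property only below its own length.
  Aperiodic : ℕ → Set
  Aperiodic M = ∀ i {t} → t ≤ M → fold i S t ≡ i → t ≡ 0

  -- Cancelling `u` steps, by injectivity of `S`, leaves `v ∸ u` as a period.
  sorted-orbit-injective : ∀ {M} → Aperiodic M → ∀ i {u v} → u ≤ v → v ≤ M →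
                           fold i S u ≡ fold i S v → u ≡ v
  sorted-orbit-injective aperiodic i {u} {v} u≤v v≤M eq = ℕ.≤-antisym u≤v (ℕ.m∸n≡0⇒m≤n
    (aperiodic i (ℕ.≤-trans (ℕ.m∸n≤m v u) v≤M) (S^-inj u (begin
      fold (fold i S (v ∸ u)) S u  ≡⟨ fold-+ i S u ⟨
      fold i S (u + (v ∸ u))       ≡⟨ cong (fold i S) (ℕ.m+[n∸m]≡n u≤v) ⟩
      fold i S v                   ≡⟨ eq ⟨
      fold i S u                   ∎))))
    where open ≡-Reasoning

  orbit-injective : ∀ {M} → Aperiodic M → ∀ i {u v} → u ≤ M → v ≤ M →
                    fold i S u ≡ fold i S v → u ≡ v
  orbit-injective {M} aperiodic i {u} {v} u≤M v≤M eq with ℕ.≤-total u v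
  ... | inj₁ u≤v = sorted-orbit-injective aperiodic i u≤v v≤M eq
  ... | inj₂ v≤u = sym (sorted-orbit-injective aperiodic i v≤u u≤M (sym eq))

-- The category of a chain, and the inclusions forced in any representation.

module Gadgets (𝓒 : Chain) where
  open Chain 𝓒

  data Obj : Set where
    X Y : Obj
    Z W : I → Obj

  -- The name of a composite lists its factors, so that eg i is e i ⨾ g i.
  data Hom : Obj → Obj → Set where
    ι       : ∀ {A} → Hom A A
    p peg   : ∀ i → Hom X (Z i)
    pe      : ∀ i → Hom X (W i)
    e       : ∀ i → Hom (Z i) (W i)
    g       : ∀ i → Hom (W i) (Z i)
    eg      : ∀ i → Hom (Z i) (Z i)
    q egq   : ∀ i → Hom (Z i) Y
    gq      : ∀ i → Hom (W i) Y
    a       : I → Hom X Y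

  infixl 7 _⨾_
  -- Paths are concatenated and `g i ⨾ e i` cancels. The long path through the gadget at `i`
  -- receives the same name as the short path through the gadget at `S i`, which glues neighbouring
  -- gadgets.
  _⨾_ : ∀ {A B C} → Hom A B → Hom B C → Hom A C
  ι     ⨾ h     = h
  p i   ⨾ ι     = p i
  p i   ⨾ e _   = pe i
  p i   ⨾ eg _  = peg i
  p i   ⨾ q _   = a i
  p i   ⨾ egq _ = a (S i)
  peg i ⨾ ι     = peg i
  peg i ⨾ e _   = pe i
  peg i ⨾ eg _  = peg i
  peg i ⨾ q _   = a (S i)
  peg i ⨾ egq _ = a (S i)
  pe i  ⨾ ι     = pe i
  pe i  ⨾ g _   = peg i
  pe i  ⨾ gq _  = a (S i)
  e i   ⨾ ι     = e i
  e i   ⨾ g _   = eg i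
  e i   ⨾ gq _  = egq i
  g i   ⨾ ι     = g i
  g i   ⨾ e _   = ι
  g i   ⨾ eg _  = g i
  g i   ⨾ q _   = gq i
  g i   ⨾ egq _ = gq i
  eg i  ⨾ ι     = eg i
  eg i  ⨾ e _   = e i
  eg i  ⨾ eg _  = eg i
  eg i  ⨾ q _   = egq i
  eg i  ⨾ egq _ = egq i
  q i   ⨾ ι     = q i
  egq i ⨾ ι     = egq i
  gq i  ⨾ ι     = gq i
  a i   ⨾ ι     = a i

  _≟ₒ_ : DecidableEquality Obj
  X   ≟ₒ X   = yes refl
  X   ≟ₒ Y   = no λ ()
  X   ≟ₒ Z _ = no λ ()
  X   ≟ₒ W _ = no λ ()
  Y   ≟ₒ X   = no λ ()
  Y   ≟ₒ Y   = yes refl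
  Y   ≟ₒ Z _ = no λ ()
  Y   ≟ₒ W _ = no λ ()
  Z _ ≟ₒ X   = no λ ()
  Z _ ≟ₒ Y   = no λ ()
  Z i ≟ₒ Z j = map′ (cong Z) (λ { refl → refl }) (i ≟ j)
  Z _ ≟ₒ W _ = no λ ()
  W _ ≟ₒ X   = no λ ()
  W _ ≟ₒ Y   = no λ ()
  W _ ≟ₒ Z _ = no λ ()
  W i ≟ₒ W j = map′ (cong W) (λ { refl → refl }) (i ≟ j)

  open ZeroAdjoined Obj _≟ₒ_ Hom ι _⨾_ public

  module Cyclic (rep : Representable algebra) where
    open Representation rep

    -- The demonic side condition is automatic: `rn (mor f)` and `dm (mor h)` are the same element,
    -- so every endpoint of `f` lies in the domain of `h`.
    θ-⨾ : ∀ {A B C} (f : Hom A B) (h : Hom B C) {x y z} →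
          θ (mor f) x y → θ (mor h) y z → θ (mor (f ⨾ h)) x z
    θ-⨾ f h fxy hyz rewrite sym (·-composable f h) =
      from (pres-* (mor f) (mor h) _ _)
        ((_ , fxy , hyz) , λ u fxu →
          to (pres-D (mor h) u u) (from (pres-R (mor f) u u) (refl , _ , fxu)))

    -- A point z with p x z and q z y has some w with e z w.  As R g = ι, also g w′ z for
    -- some w′, and g ⨾ e = ι forces w′ = w; hence z is reached from x along p ⨾ e ⨾ g.
    a⊆aS : ∀ i {x y} → θ (mor (a i)) x y → θ (mor (a (S i))) x y
    a⊆aS i {x} {y} axy
      with (z , pxz , qzy) , _ ← to (pres-* (mor (p i)) (mor (q i)) x y)
             (subst (λ c → θ c x y) (sym (·-composable (p i) (q i))) axy)
      with zz ← from (pres-D (mor (q i)) z z) (refl , _ , qzy)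
      with _ , w , ezw ← to (pres-D (mor (e i)) z z) zz
      with _ , w′ , gw′z ← to (pres-R (mor (g i)) z z) zz
      with refl , _ ← to (pres-D (mor (ι {W i})) w′ w) (θ-⨾ (g i) (e i) gw′z ezw)
      = θ-⨾ (pe i) (gq i) (θ-⨾ (p i) (e i) pxz ezw) (θ-⨾ (g i) (q i) gw′z qzy)

    a⊆aS^ : ∀ n i {x y} → θ (mor (a i)) x y → θ (mor (a (fold i S n))) x y
    a⊆aS^ zero    i axy = axy
    a⊆aS^ (suc n) i axy = a⊆aS _ (a⊆aS^ n i axy)

    -- Walking the rest of the way round, from `S i` back to `i`, gives the inclusion converse to
    -- `a⊆aS`; faithfulness then identifies the two arrows.
    cycle-trivial : ∀ n i → fold i S (suc n) ≡ i → S i ≡ i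
    cycle-trivial n i cyc = sym (a-injective (inj _ _ λ x y → mk⇔ (a⊆aS i) λ aS →
      subst (λ j → θ (mor (a j)) x y) (trans (commute n i) cyc) (a⊆aS^ n (S i) aS)))
      where
      a-injective : ∀ {i j} → mor (a i) ≡ mor (a j) → i ≡ j
      a-injective refl = refl
      commute : ∀ n i → fold (S i) S n ≡ fold i S (suc n)
      commute zero    i = refl
      commute (suc n) i = cong S (commute n i)

-- The structure of ℤ is representable.

module Integers where

  S^≡+ : ∀ i n → fold i ℤ.suc n ≡ + n ℤ.+ i
  S^≡+ i zero    = sym (ℤ.+-identityˡ i)
  S^≡+ i (suc n) = trans (cong ℤ.suc (S^≡+ i n)) (sym (ℤ.+-assoc 1ℤ (+ n) i))

  bounded : ∀ {m} (a : Fin m → ℤ) → ∃ λ b → ∀ k → a k ℤ.≤ + b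
  bounded {zero}  a = 0 , λ ()
  bounded {suc m} a with bounded (a ∘ suc)
  ... | b , a≤b = ∣ a zero ∣ + b , λ
    { zero    → ℤ.≤-trans (i≤+∣i∣ (a zero)) (ℤ.+≤+ (ℕ.m≤m+n _ b))
    ; (suc k) → ℤ.≤-trans (a≤b k) (ℤ.+≤+ (ℕ.m≤n+m b _)) }
    where
    i≤+∣i∣ : ∀ i → i ℤ.≤ + ∣ i ∣
    i≤+∣i∣ (+ n)        = ℤ.≤-refl
    i≤+∣i∣ (ℤ.-[1+ n ]) = ℤ.-≤+

  chain : Chain
  chain = record
    { I = ℤ ; _≟_ = ℤ._≟_ ; S = ℤ.suc
    ; S-inj  = λ {i} {j} eq → trans (sym (ℤ.pred-suc i)) (trans (cong ℤ.pred eq) (ℤ.pred-suc j))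
    ; S-surj = λ i → ℤ.pred i , ℤ.suc-pred i
    ; fresh  = fresh }
    where
    fresh : ∀ M {m} (a : Fin m → ℤ) →
            ∃ λ i → ∀ k {s t} → s ≤ M → t ≤ M → fold i ℤ.suc s ≢ fold (a k) ℤ.suc t
    fresh M a with bounded a
    -- Within `M` steps no `a k` gets beyond `M + b`, so the fresh element starts above that.
    ... | b , a≤b = + suc (M + b) , λ k {s} {t} s≤M t≤M eq → ℤ.<-irrefl
      (trans (sym (S^≡+ (a k) t)) (trans (sym eq) (S^≡+ (+ suc (M + b)) s)))
      (ℤ.≤-<-trans (ℤ.+-mono-≤ (ℤ.+≤+ t≤M) (a≤b k))
        (ℤ.+<+ (ℕ.m≤n+m (suc (M + b)) s)))

  aperiodic : ∀ M → Chain.Aperiodic chain M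
  aperiodic M i {t} _ eq = ℤ.+-injective (∙-cancelʳ i (+ t) (+ 0)
    (trans (sym (S^≡+ i t)) (trans eq (sym (ℤ.+-identityˡ i)))))

  open Gadgets chain

  -- A point (b , w) of Z i lies over the point w of W i and has level w or w + 1.  The arrow a i
  -- is y ≤ x + i; p and q see the level of a point of Z i, while e only sees the point below.
  Pt : Obj → Set
  Pt X     = ℤ
  Pt Y     = ℤ
  Pt (W _) = ℤ
  Pt (Z _) = Bool × ℤ

  level : Bool × ℤ → ℤ
  level (false , w) = w
  level (true  , w) = ℤ.suc w

  base≤level : ∀ z → proj₂ z ℤ.≤ level z
  base≤level (false , w) = ℤ.≤-refl
  base≤level (true  , w) = ℤ.i≤suc[i] w

  level≤suc-base : ∀ z → level z ℤ.≤ ℤ.suc (proj₂ z)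
  level≤suc-base (false , w) = ℤ.i≤suc[i] w
  level≤suc-base (true  , w) = ℤ.≤-refl

  -- Passing through `W i` forgets the level, which may then be chosen anew: `peg` and `pe` only
  -- bound the base, while `egq` and `gq` profit from the upper point over it. This is where
  -- `a (S i)` gains one over `a i`.
  ⟪_⟫ : ∀ {A B} → Hom A B → Pt A → Pt B → Set
  ⟪ ι     ⟫ x y = x ≡ y
  ⟪ p i   ⟫ x z = level z ℤ.≤ x
  ⟪ peg i ⟫ x z = proj₂ z ℤ.≤ x
  ⟪ pe i  ⟫ x w = w ℤ.≤ x
  ⟪ e i   ⟫ z w = proj₂ z ≡ w
  ⟪ g i   ⟫ w z = w ≡ proj₂ z
  ⟪ eg i  ⟫ z u = proj₂ z ≡ proj₂ u
  ⟪ q i   ⟫ z y = y ℤ.≤ level z ℤ.+ i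
  ⟪ egq i ⟫ z y = y ℤ.≤ ℤ.suc (proj₂ z) ℤ.+ i
  ⟪ gq i  ⟫ w y = y ℤ.≤ ℤ.suc w ℤ.+ i
  ⟪ a i   ⟫ x y = y ℤ.≤ x ℤ.+ i

  suc-swap : ∀ x i → ℤ.suc x ℤ.+ i ≡ x ℤ.+ ℤ.suc i
  suc-swap x i = trans (cong (ℤ._+ i) (ℤ.+-comm 1ℤ x)) (ℤ.+-assoc x 1ℤ i)

  via : ∀ {y u v} i → y ℤ.≤ u ℤ.+ i → u ℤ.≤ v → y ℤ.≤ v ℤ.+ i
  via i y≤u+i u≤v = ℤ.≤-trans y≤u+i (ℤ.+-monoˡ-≤ i u≤v)

  via-suc : ∀ {x y w} i → y ℤ.≤ ℤ.suc w ℤ.+ i → w ℤ.≤ x → y ℤ.≤ x ℤ.+ ℤ.suc i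
  via-suc {x} i y≤ w≤x = ℤ.≤-trans (via i y≤ (ℤ.suc-mono w≤x)) (ℤ.≤-reflexive (suc-swap x i))

  unswap : ∀ {y} x i → y ℤ.≤ x ℤ.+ ℤ.suc i → y ℤ.≤ ℤ.suc x ℤ.+ i
  unswap x i y≤ = ℤ.≤-trans y≤ (ℤ.≤-reflexive (sym (suc-swap x i)))

  -- For a midpoint in some `Z i`, the lower point serves after `p`, which asks for a small level,
  -- and the upper point serves before `q` once `g` has left the level free.
  ⟪⟫-⨾ : ∀ {A B C} (f : Hom A B) (h : Hom B C) {x z} →
         ⟪ f ⨾ h ⟫ x z ⇔ (∃ λ y → ⟪ f ⟫ x y × ⟪ h ⟫ y z)
  ⟪⟫-⨾ ι h = mk⇔ (λ r → _ , refl , r) λ { (_ , refl , r) → r }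
  ⟪⟫-⨾ (p i) ι = mk⇔ (λ r → _ , r , refl) λ { (_ , r , refl) → r }
  ⟪⟫-⨾ (p i) (e _) = mk⇔ (λ r → (false , _) , r , refl)
    λ { (z , r , refl) → ℤ.≤-trans (base≤level z) r }
  ⟪⟫-⨾ (p i) (eg _) = mk⇔ (λ r → (false , _) , r , refl)
    λ { (z , r , refl) → ℤ.≤-trans (base≤level z) r }
  ⟪⟫-⨾ (p i) (q _) {x} = mk⇔ (λ r → (false , x) , ℤ.≤-refl , r)
    λ { (z , r , s) → via i s r }
  ⟪⟫-⨾ (p i) (egq _) {x} = mk⇔ (λ r → (false , x) , ℤ.≤-refl , unswap x i r)
    λ { (z , r , s) → via-suc i s (ℤ.≤-trans (base≤level z) r) }
  ⟪⟫-⨾ (peg i) ι = mk⇔ (λ r → _ , r , refl) λ { (_ , r , refl) → r }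
  ⟪⟫-⨾ (peg i) (e _) = mk⇔ (λ r → (false , _) , r , refl) λ { (_ , r , refl) → r }
  ⟪⟫-⨾ (peg i) (eg _) = mk⇔ (λ r → (false , _) , r , refl) λ { (_ , r , refl) → r }
  ⟪⟫-⨾ (peg i) (q _) {x} = mk⇔ (λ r → (true , x) , ℤ.≤-refl , unswap x i r)
    λ { (z , r , s) → via-suc i (via i s (level≤suc-base z)) r }
  ⟪⟫-⨾ (peg i) (egq _) {x} = mk⇔ (λ r → (true , x) , ℤ.≤-refl , unswap x i r)
    λ { (_ , r , s) → via-suc i s r }
  ⟪⟫-⨾ (pe i) ι = mk⇔ (λ r → _ , r , refl) λ { (_ , r , refl) → r }
  ⟪⟫-⨾ (pe i) (g _) = mk⇔ (λ r → _ , r , refl) λ { (_ , r , refl) → r }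
  ⟪⟫-⨾ (pe i) (gq _) {x} = mk⇔ (λ r → x , ℤ.≤-refl , unswap x i r)
    λ { (_ , r , s) → via-suc i s r }
  ⟪⟫-⨾ (e i) ι = mk⇔ (λ r → _ , r , refl) λ { (_ , r , refl) → r }
  ⟪⟫-⨾ (e i) (g _) = mk⇔ (λ r → _ , r , refl) λ { (_ , r , refl) → r }
  ⟪⟫-⨾ (e i) (gq _) = mk⇔ (λ r → _ , refl , r) λ { (_ , refl , r) → r }
  ⟪⟫-⨾ (g i) ι = mk⇔ (λ r → _ , r , refl) λ { (_ , r , refl) → r }
  ⟪⟫-⨾ (g i) (e _) = mk⇔ (λ r → (false , _) , refl , r) λ { (_ , refl , r) → r }
  ⟪⟫-⨾ (g i) (eg _) = mk⇔ (λ r → (false , _) , refl , r) λ { (_ , refl , r) → r }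
  ⟪⟫-⨾ (g i) (q _) = mk⇔ (λ r → (true , _) , refl , r)
    λ { (z , refl , r) → via i r (level≤suc-base z) }
  ⟪⟫-⨾ (g i) (egq _) = mk⇔ (λ r → (true , _) , refl , r) λ { (_ , refl , r) → r }
  ⟪⟫-⨾ (eg i) ι = mk⇔ (λ r → _ , r , refl) λ { (_ , r , refl) → r }
  ⟪⟫-⨾ (eg i) (e _) = mk⇔ (λ r → (false , _) , r , refl) λ { (_ , r , refl) → r }
  ⟪⟫-⨾ (eg i) (eg _) = mk⇔ (λ r → (false , _) , r , refl) λ { (_ , r , s) → trans r s }
  ⟪⟫-⨾ (eg i) (q _) = mk⇔ (λ r → (true , _) , refl , r)
    λ { (z , refl , r) → via i r (level≤suc-base z) }
  ⟪⟫-⨾ (eg i) (egq _) = mk⇔ (λ r → (true , _) , refl , r) λ { (_ , refl , r) → r }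
  ⟪⟫-⨾ (q i) ι = mk⇔ (λ r → _ , r , refl) λ { (_ , r , refl) → r }
  ⟪⟫-⨾ (egq i) ι = mk⇔ (λ r → _ , r , refl) λ { (_ , r , refl) → r }
  ⟪⟫-⨾ (gq i) ι = mk⇔ (λ r → _ , r , refl) λ { (_ , r , refl) → r }
  ⟪⟫-⨾ (a i) ι = mk⇔ (λ r → _ , r , refl) λ { (_ , r , refl) → r }

  total : ∀ {A B} (f : Hom A B) x → ∃ λ y → ⟪ f ⟫ x y
  total ι       x = x , refl
  total (p i)   x = (false , x) , ℤ.≤-refl
  total (peg i) x = (false , x) , ℤ.≤-refl
  total (pe i)  x = x , ℤ.≤-refl
  total (e i)   z = proj₂ z , refl
  total (g i)   w = (false , w) , refl
  total (eg i)  z = z , refl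
  total (q i)   z = _ , ℤ.≤-refl
  total (egq i) z = _ , ℤ.≤-refl
  total (gq i)  w = _ , ℤ.≤-refl
  total (a i)   x = _ , ℤ.≤-refl

  difference : ∀ y i → y ℤ.≤ (y ℤ.- i) ℤ.+ i
  difference y i = ℤ.≤-reflexive (sym (trans (ℤ.+-assoc y (ℤ.- i) i)
    (trans (cong (λ u → y ℤ.+ u) (ℤ.+-inverseˡ i)) (ℤ.+-identityʳ y))))

  surjective : ∀ {A B} (f : Hom A B) y → ∃ λ x → ⟪ f ⟫ x y
  surjective ι       x = x , refl
  surjective (p i)   z = level z , ℤ.≤-refl
  surjective (peg i) z = proj₂ z , ℤ.≤-refl
  surjective (pe i)  w = w , ℤ.≤-refl
  surjective (e i)   w = (false , w) , refl
  surjective (g i)   z = proj₂ z , refl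
  surjective (eg i)  z = z , refl
  surjective (q i)   y = (false , y ℤ.- i) , difference y i
  surjective (egq i) y = (true , y ℤ.- i) , via i (difference y i) (ℤ.i≤suc[i] (y ℤ.- i))
  surjective (gq i)  y = y ℤ.- i , via i (difference y i) (ℤ.i≤suc[i] (y ℤ.- i))
  surjective (a i)   y = y ℤ.- i , difference y i

  point : ∀ A → Pt A
  point X     = 1ℤ
  point Y     = 1ℤ
  point (Z _) = false , 1ℤ
  point (W _) = 1ℤ

  -- The pair of `0` and `i` lies on the boundary of the relation of `a i`.
  a-reflects : ∀ {i j} → (∀ {x y} → ⟪ a i ⟫ x y → ⟪ a j ⟫ x y) → i ℤ.≤ j
  a-reflects {i} {j} a⊆a = ℤ.≤-trans (a⊆a {+ 0} {i} (ℤ.≤-reflexive (sym (ℤ.+-identityˡ i))))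
                             (ℤ.≤-reflexive (ℤ.+-identityˡ j))

  suc≰ : ∀ w → ¬ ℤ.suc w ℤ.≤ w
  suc≰ w s = ℤ.<-irrefl refl (ℤ.suc[i]≤j⇒i<j s)

  -- Here and in the next two lemmas, arrows that differ by a factor `eg i` are separated by the
  -- points `(false , w)` and `(true , w)` over a common `w`; hence the two levels in `Z i`.
  p≢peg : ∀ i → ¬ (∀ x z → ⟪ p i ⟫ x z ⇔ ⟪ peg i ⟫ x z)
  p≢peg i eq = suc≰ 1ℤ (from (eq 1ℤ (true , 1ℤ)) ℤ.≤-refl)

  ι≢eg : ∀ i → ¬ (∀ x z → ⟪ ι {Z i} ⟫ x z ⇔ ⟪ eg i ⟫ x z)
  ι≢eg i eq with from (eq (false , 1ℤ) (true , 1ℤ)) refl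
  ... | ()

  q≢egq : ∀ i → ¬ (∀ z y → ⟪ q i ⟫ z y ⇔ ⟪ egq i ⟫ z y)
  q≢egq i eq = suc≰ (1ℤ ℤ.+ i) (ℤ.≤-trans
    (ℤ.≤-reflexive (sym (ℤ.+-assoc 1ℤ 1ℤ i))) (from (eq (false , 1ℤ) _) ℤ.≤-refl))

  faithful : ∀ {A B} (f h : Hom A B) → (∀ x y → ⟪ f ⟫ x y ⇔ ⟪ h ⟫ x y) → f ≡ h
  faithful ι       ι       eq = refl
  faithful ι       (eg i)  eq = ⊥-elim (ι≢eg i eq)
  faithful (eg i)  ι       eq = ⊥-elim (ι≢eg i λ x z → ⇔-sym (eq x z))
  faithful (eg _)  (eg _)  eq = refl
  faithful (p _)   (p _)   eq = refl
  faithful (p i)   (peg _) eq = ⊥-elim (p≢peg i eq)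
  faithful (peg i) (p _)   eq = ⊥-elim (p≢peg i λ x z → ⇔-sym (eq x z))
  faithful (peg _) (peg _) eq = refl
  faithful (q _)   (q _)   eq = refl
  faithful (q i)   (egq _) eq = ⊥-elim (q≢egq i eq)
  faithful (egq i) (q _)   eq = ⊥-elim (q≢egq i λ x z → ⇔-sym (eq x z))
  faithful (egq _) (egq _) eq = refl
  faithful (pe _)  (pe _)  eq = refl
  faithful (e _)   (e _)   eq = refl
  faithful (g _)   (g _)   eq = refl
  faithful (gq _)  (gq _)  eq = refl
  faithful (a i)   (a j)   eq = cong a (ℤ.≤-antisym
    (a-reflects {i} λ {x y} → to (eq x y)) (a-reflects {j} λ {x y} → from (eq x y)))

  representable : Representable algebra
  representable = Functor.representation Pt ⟪_⟫ (λ {A} → mk⇔ id id) ⟪⟫-⨾ total surjective point faithful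

-- Disjoint unions of a long cycle.

-- Infinitely many copies of the cycle are taken so that a fresh element always exists.
module Cycles (n′ : ℕ) where

  n : ℕ
  n = suc n′

  next : Fin n → Fin n
  next c = fromℕ< (m%n<n (suc (toℕ c)) n)

  step : ℕ × Fin n → ℕ × Fin n
  step (k , c) = k , next c

  next^-% : ∀ t c → toℕ (fold c next t) ≡ (t + toℕ c) % n
  next^-% zero    c = sym (m<n⇒m%n≡m (Fin.toℕ<n c))
  next^-% (suc t) c = begin
    toℕ (next (fold c next t))               ≡⟨ Fin.toℕ-fromℕ< _ ⟩
    suc (toℕ (fold c next t)) % n            ≡⟨ cong (λ u → suc u % n) (next^-% t c) ⟩
    suc ((t + toℕ c) % n) % n                ≡⟨ %-distribˡ-+ 1 ((t + toℕ c) % n) n ⟩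
    (1 % n + (t + toℕ c) % n % n) % n        ≡⟨ cong (λ u → (1 % n + u) % n) (m%n%n≡m%n (t + toℕ c) n) ⟩
    (1 % n + (t + toℕ c) % n) % n            ≡⟨ %-distribˡ-+ 1 (t + toℕ c) n ⟨
    suc (t + toℕ c) % n                      ∎
    where open ≡-Reasoning

  next^n : ∀ c → fold c next n ≡ c
  next^n c = Fin.toℕ-injective (begin
    toℕ (fold c next n)  ≡⟨ next^-% n c ⟩
    (n + toℕ c) % n      ≡⟨ cong (_% n) (ℕ.+-comm n (toℕ c)) ⟩
    (toℕ c + n) % n      ≡⟨ [m+n]%n≡m%n (toℕ c) n ⟩
    toℕ c % n            ≡⟨ m<n⇒m%n≡m (Fin.toℕ<n c) ⟩
    toℕ c                ∎)
    where open ≡-Reasoning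

  step^ : ∀ t k c → fold (k , c) step t ≡ (k , fold c next t)
  step^ zero    k c = refl
  step^ (suc t) k c = cong step (step^ t k c)

  step^n : ∀ i → fold i step n ≡ i
  step^n (k , c) = trans (step^ n k c) (cong (k ,_) (next^n c))

  step^-comm : ∀ t i → fold (step i) step t ≡ step (fold i step t)
  step^-comm zero    i = refl
  step^-comm (suc t) i = cong step (step^-comm t i)

  bounded : ∀ {m} (a : Fin m → ℕ) → ∃ λ b → ∀ k → a k < b
  bounded {zero}  a = 0 , λ ()
  bounded {suc m} a with bounded (a ∘ suc)
  ... | b , a<b = suc (a zero) + b , λ
    { zero    → ℕ.m≤m+n (suc (a zero)) b
    ; (suc k) → ℕ.≤-trans (a<b k) (ℕ.m≤n+m b (suc (a zero))) }

  chain : Chain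
  chain = record
    { I = ℕ × Fin n ; _≟_ = ≡-dec ℕ._≟_ Fin._≟_ ; S = step
    -- On cycles of length `n`, a further `n′` steps undo `step`.
    ; S-inj  = λ {i} {j} eq → trans (sym (undo i)) (trans (cong (λ u → fold u step n′) eq) (undo j))
    ; S-surj = λ i → fold i step n′ , step^n i
    ; fresh  = fresh }
    where
    undo : ∀ i → fold (step i) step n′ ≡ i
    undo i = trans (step^-comm n′ i) (step^n i)
    fresh : ∀ M {m} (a : Fin m → ℕ × Fin n) →
            ∃ λ i → ∀ k {s t} → s ≤ M → t ≤ M → fold i step s ≢ fold (a k) step t
    fresh M a with bounded (proj₁ ∘ a)
    -- No `a k` lies in copy `b`, and `step` never leaves a copy.
    ... | b , a<b = (b , zero) , λ k {s} {t} _ _ eq → ℕ.<-irrefl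
      (cong proj₁ (trans (sym (step^ t _ _)) (trans (sym eq) (step^ s b zero)))) (a<b k)

  -- As `step` adds 1 modulo `n`, a return after `t` steps makes `t` a multiple of `n`.
  step^-aperiodic : ∀ {t} → t < n → ∀ i → fold i step t ≡ i → t ≡ 0
  step^-aperiodic {t} t<n i@(k , c) eq = multiple<n⇒0 ((t + toℕ c) / n) (ℕ.+-cancelʳ-≡ (toℕ c) t _ (begin
    t + toℕ c                                  ≡⟨ m≡m%n+[m/n]*n (t + toℕ c) n ⟩
    (t + toℕ c) % n + (t + toℕ c) / n * n      ≡⟨ cong (_+ (t + toℕ c) / n * n) fixed ⟩
    toℕ c + (t + toℕ c) / n * n                ≡⟨ ℕ.+-comm (toℕ c) _ ⟩
    (t + toℕ c) / n * n + toℕ c                ∎))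
    where
    open ≡-Reasoning
    fixed : (t + toℕ c) % n ≡ toℕ c
    fixed = trans (sym (next^-% t c)) (cong (toℕ ∘ proj₂) (trans (sym (step^ t k c)) eq))
    multiple<n⇒0 : ∀ d → t ≡ d * n → t ≡ 0
    multiple<n⇒0 zero    t≡0 = t≡0
    multiple<n⇒0 (suc d) t≡  = contradiction (ℕ.<-≤-trans t<n (ℕ.m≤m+n n (d * n))) (ℕ.<-irrefl t≡)

  aperiodic : Chain.Aperiodic chain n′
  aperiodic i t≤n′ = step^-aperiodic (s≤s t≤n′) i

-- Positions of the game.

-- A position of the Ehrenfeucht–Fraïssé game is a pair of tuples α, β of chain elements.
-- Near allows one step beyond them because p ⨾ egq = a (S i) is the only way for a
-- composite to leave the named part of the chain, and arrows a i yield no new gadget.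
module Position (𝓐 𝓑 : Chain) {m : ℕ} (α : Fin m → Chain.I 𝓐) (β : Fin m → Chain.I 𝓑) where
  open Chain 𝓐
  open Chain 𝓑 using () renaming (I to J; S to S′)
  module 𝔸 = Gadgets 𝓐
  module 𝔹 = Gadgets 𝓑

  -- As `S` is injective, two forward offsets encode a signed distance of size at most `M`.
  Similar : ℕ → Set
  Similar M = ∀ k l {s t} → s ≤ M → t ≤ M →
              (fold (α k) S s ≡ fold (α l) S t) ⇔ (fold (β k) S′ s ≡ fold (β l) S′ t)

  data Near (T : ℕ) : I → J → Set where
    near : ∀ k {t} → t ≤ T → Near T (fold (α k) S t) (fold (β k) S′ t)

  data Objs : 𝔸.Obj → 𝔹.Obj → Set where
    X : Objs 𝔸.X 𝔹.X
    Y : Objs 𝔸.Y 𝔹.Y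
    Z : ∀ {i j} → Near 0 i j → Objs (𝔸.Z i) (𝔹.Z j)
    W : ∀ {i j} → Near 0 i j → Objs (𝔸.W i) (𝔹.W j)

  data Homs : ∀ {A B A′ B′} → 𝔸.Hom A B → 𝔹.Hom A′ B′ → Set where
    ι   : ∀ {A A′} → Objs A A′ → Homs (𝔸.ι {A}) (𝔹.ι {A′})
    p   : ∀ {i j} → Near 0 i j → Homs (𝔸.p i) (𝔹.p j)
    peg : ∀ {i j} → Near 0 i j → Homs (𝔸.peg i) (𝔹.peg j)
    pe  : ∀ {i j} → Near 0 i j → Homs (𝔸.pe i) (𝔹.pe j)
    e   : ∀ {i j} → Near 0 i j → Homs (𝔸.e i) (𝔹.e j)
    g   : ∀ {i j} → Near 0 i j → Homs (𝔸.g i) (𝔹.g j)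
    eg  : ∀ {i j} → Near 0 i j → Homs (𝔸.eg i) (𝔹.eg j)
    q   : ∀ {i j} → Near 0 i j → Homs (𝔸.q i) (𝔹.q j)
    egq : ∀ {i j} → Near 0 i j → Homs (𝔸.egq i) (𝔹.egq j)
    gq  : ∀ {i j} → Near 0 i j → Homs (𝔸.gq i) (𝔹.gq j)
    a   : ∀ {i j} → Near 1 i j → Homs (𝔸.a i) (𝔹.a j)

  data Els : 𝔸.El → 𝔹.El → Set where
    ∅   : Els 𝔸.∅ 𝔹.∅
    mor : ∀ {A B A′ B′} {f : 𝔸.Hom A B} {f′ : 𝔹.Hom A′ B′} → Homs f f′ → Els (𝔸.mor f) (𝔹.mor f′)

  here : ∀ {i j} → Near 0 i j → Near 1 i j
  here (near k z≤n) = near k z≤n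

  next : ∀ {i j} → Near 0 i j → Near 1 (S i) (S′ j)
  next (near k z≤n) = near k (s≤s z≤n)

  Objs-source : ∀ {A B A′ B′} {f : 𝔸.Hom A B} {f′ : 𝔹.Hom A′ B′} → Homs f f′ → Objs A A′
  Objs-source (ι r)   = r
  Objs-source (p _)   = X
  Objs-source (peg _) = X
  Objs-source (pe _)  = X
  Objs-source (e r)   = Z r
  Objs-source (g r)   = W r
  Objs-source (eg r)  = Z r
  Objs-source (q r)   = Z r
  Objs-source (egq r) = Z r
  Objs-source (gq r)  = W r
  Objs-source (a _)   = X

  Objs-target : ∀ {A B A′ B′} {f : 𝔸.Hom A B} {f′ : 𝔹.Hom A′ B′} → Homs f f′ → Objs B B′
  Objs-target (ι r)   = r
  Objs-target (p r)   = Z r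
  Objs-target (peg r) = Z r
  Objs-target (pe r)  = W r
  Objs-target (e r)   = W r
  Objs-target (g r)   = Z r
  Objs-target (eg r)  = Z r
  Objs-target (q _)   = Y
  Objs-target (egq _) = Y
  Objs-target (gq _)  = Y
  Objs-target (a _)   = Y

  Homs-⨾ : ∀ {A B C A′ B′ C′} {f : 𝔸.Hom A B} {f′ : 𝔹.Hom A′ B′} {h : 𝔸.Hom B C} {h′ : 𝔹.Hom B′ C′} →
           Homs f f′ → Homs h h′ → Homs (f 𝔸.⨾ h) (f′ 𝔹.⨾ h′)
  Homs-⨾ (ι _)   r       = r
  Homs-⨾ (p r)   (ι _)   = p r
  Homs-⨾ (p r)   (e _)   = pe r
  Homs-⨾ (p r)   (eg _)  = peg r
  Homs-⨾ (p r)   (q _)   = a (here r)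
  Homs-⨾ (p r)   (egq _) = a (next r)
  Homs-⨾ (peg r) (ι _)   = peg r
  Homs-⨾ (peg r) (e _)   = pe r
  Homs-⨾ (peg r) (eg _)  = peg r
  Homs-⨾ (peg r) (q _)   = a (next r)
  Homs-⨾ (peg r) (egq _) = a (next r)
  Homs-⨾ (pe r)  (ι _)   = pe r
  Homs-⨾ (pe r)  (g _)   = peg r
  Homs-⨾ (pe r)  (gq _)  = a (next r)
  Homs-⨾ (e r)   (ι _)   = e r
  Homs-⨾ (e r)   (g _)   = eg r
  Homs-⨾ (e r)   (gq _)  = egq r
  Homs-⨾ (g r)   (ι _)   = g r
  Homs-⨾ (g r)   (e _)   = ι (W r)
  Homs-⨾ (g r)   (eg _)  = g r
  Homs-⨾ (g r)   (q _)   = gq r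
  Homs-⨾ (g r)   (egq _) = gq r
  Homs-⨾ (eg r)  (ι _)   = eg r
  Homs-⨾ (eg r)  (e _)   = e r
  Homs-⨾ (eg r)  (eg _)  = eg r
  Homs-⨾ (eg r)  (q _)   = egq r
  Homs-⨾ (eg r)  (egq _) = egq r
  Homs-⨾ (q r)   (ι _)   = q r
  Homs-⨾ (egq r) (ι _)   = egq r
  Homs-⨾ (gq r)  (ι _)   = gq r
  Homs-⨾ (a r)   (ι _)   = a r

  module Functional (sim : Similar 1) where

    Near-functional : ∀ {T i i′ j j′} → T ≤ 1 → Near T i j → Near T i′ j′ → i ≡ i′ → j ≡ j′
    Near-functional T≤1 (near k s≤T) (near l t≤T) =
      to (sim k l (ℕ.≤-trans s≤T T≤1) (ℕ.≤-trans t≤T T≤1))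

    ≡₀ : ∀ {i j j′} → Near 0 i j → Near 0 i j′ → j ≡ j′
    ≡₀ r s = Near-functional z≤n r s refl

    Objs-functional : ∀ {A A′ A″} → Objs A A′ → Objs A A″ → A′ ≡ A″
    Objs-functional X     X      = refl
    Objs-functional Y     Y      = refl
    Objs-functional (Z r) (Z r′) = cong 𝔹.Z (≡₀ r r′)
    Objs-functional (W r) (W r′) = cong 𝔹.W (≡₀ r r′)

    -- Gives the transfer of equations: equal elements have equal partners.
    Els-functional : ∀ {x x′ x″} → Els x x′ → Els x x″ → x′ ≡ x″
    Els-functional ∅             ∅              = refl
    Els-functional (mor (ι r))   (mor (ι r′))   = cong (λ A → 𝔹.mor (𝔹.ι {A})) (Objs-functional r r′)
    Els-functional (mor (p r))   (mor (p r′))   = cong (λ j → 𝔹.mor (𝔹.p j)) (≡₀ r r′)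
    Els-functional (mor (peg r)) (mor (peg r′)) = cong (λ j → 𝔹.mor (𝔹.peg j)) (≡₀ r r′)
    Els-functional (mor (pe r))  (mor (pe r′))  = cong (λ j → 𝔹.mor (𝔹.pe j)) (≡₀ r r′)
    Els-functional (mor (e r))   (mor (e r′))   = cong (λ j → 𝔹.mor (𝔹.e j)) (≡₀ r r′)
    Els-functional (mor (g r))   (mor (g r′))   = cong (λ j → 𝔹.mor (𝔹.g j)) (≡₀ r r′)
    Els-functional (mor (eg r))  (mor (eg r′))  = cong (λ j → 𝔹.mor (𝔹.eg j)) (≡₀ r r′)
    Els-functional (mor (q r))   (mor (q r′))   = cong (λ j → 𝔹.mor (𝔹.q j)) (≡₀ r r′)
    Els-functional (mor (egq r)) (mor (egq r′)) = cong (λ j → 𝔹.mor (𝔹.egq j)) (≡₀ r r′)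
    Els-functional (mor (gq r))  (mor (gq r′))  = cong (λ j → 𝔹.mor (𝔹.gq j)) (≡₀ r r′)
    Els-functional (mor (a r))   (mor (a r′))   =
      cong (λ j → 𝔹.mor (𝔹.a j)) (Near-functional ℕ.≤-refl r r′ refl)

-- Symmetry and extension of positions.

module Flip (𝓐 𝓑 : Chain) {m : ℕ} (α : Fin m → Chain.I 𝓐) (β : Fin m → Chain.I 𝓑) where
  module P = Position 𝓐 𝓑 α β
  module Q = Position 𝓑 𝓐 β α

  Near-flip : ∀ {T i j} → P.Near T i j → Q.Near T j i
  Near-flip (P.near k t≤T) = Q.near k t≤T

  Objs-flip : ∀ {A A′} → P.Objs A A′ → Q.Objs A′ A
  Objs-flip P.X     = Q.X
  Objs-flip P.Y     = Q.Y
  Objs-flip (P.Z r) = Q.Z (Near-flip r)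
  Objs-flip (P.W r) = Q.W (Near-flip r)

  Els-flip : ∀ {x x′} → P.Els x x′ → Q.Els x′ x
  Els-flip P.∅               = Q.∅
  Els-flip (P.mor (P.ι r))   = Q.mor (Q.ι (Objs-flip r))
  Els-flip (P.mor (P.p r))   = Q.mor (Q.p (Near-flip r))
  Els-flip (P.mor (P.peg r)) = Q.mor (Q.peg (Near-flip r))
  Els-flip (P.mor (P.pe r))  = Q.mor (Q.pe (Near-flip r))
  Els-flip (P.mor (P.e r))   = Q.mor (Q.e (Near-flip r))
  Els-flip (P.mor (P.g r))   = Q.mor (Q.g (Near-flip r))
  Els-flip (P.mor (P.eg r))  = Q.mor (Q.eg (Near-flip r))
  Els-flip (P.mor (P.q r))   = Q.mor (Q.q (Near-flip r))
  Els-flip (P.mor (P.egq r)) = Q.mor (Q.egq (Near-flip r))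
  Els-flip (P.mor (P.gq r))  = Q.mor (Q.gq (Near-flip r))
  Els-flip (P.mor (P.a r))   = Q.mor (Q.a (Near-flip r))

  Similar-flip : ∀ {M} → P.Similar M → Q.Similar M
  Similar-flip sim k l s≤M t≤M = ⇔-sym (sim k l s≤M t≤M)

module Extension (𝓐 𝓑 : Chain) {m : ℕ} (α : Fin m → Chain.I 𝓐) (β : Fin m → Chain.I 𝓑)
  (i : Chain.I 𝓐) (j : Chain.I 𝓑) where
  module P = Position 𝓐 𝓑 α β
  module Q = Position 𝓐 𝓑 (extend i α) (extend j β)

  Near-extend : ∀ {T i j} → P.Near T i j → Q.Near T i j
  Near-extend (P.near k t≤T) = Q.near (suc k) t≤T

  Objs-extend : ∀ {A A′} → P.Objs A A′ → Q.Objs A A′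
  Objs-extend P.X     = Q.X
  Objs-extend P.Y     = Q.Y
  Objs-extend (P.Z r) = Q.Z (Near-extend r)
  Objs-extend (P.W r) = Q.W (Near-extend r)

  Els-extend : ∀ {x x′} → P.Els x x′ → Q.Els x x′
  Els-extend P.∅               = Q.∅
  Els-extend (P.mor (P.ι r))   = Q.mor (Q.ι (Objs-extend r))
  Els-extend (P.mor (P.p r))   = Q.mor (Q.p (Near-extend r))
  Els-extend (P.mor (P.peg r)) = Q.mor (Q.peg (Near-extend r))
  Els-extend (P.mor (P.pe r))  = Q.mor (Q.pe (Near-extend r))
  Els-extend (P.mor (P.e r))   = Q.mor (Q.e (Near-extend r))
  Els-extend (P.mor (P.g r))   = Q.mor (Q.g (Near-extend r))
  Els-extend (P.mor (P.eg r))  = Q.mor (Q.eg (Near-extend r))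
  Els-extend (P.mor (P.q r))   = Q.mor (Q.q (Near-extend r))
  Els-extend (P.mor (P.egq r)) = Q.mor (Q.egq (Near-extend r))
  Els-extend (P.mor (P.gq r))  = Q.mor (Q.gq (Near-extend r))
  Els-extend (P.mor (P.a r))   = Q.mor (Q.a (Near-extend r))

-- Replies to a move.

module Moves (𝓐 𝓑 : Chain) {m : ℕ} (α : Fin m → Chain.I 𝓐) (β : Fin m → Chain.I 𝓑) where
  open Chain 𝓐
  open Chain 𝓑 using () renaming
    ( I to J; S to S′; fresh to fresh′; S^-surj to S′^-surj
    ; shift-⇔ to shift-⇔′; orbit-injective to orbit-injective′)
  open Position 𝓐 𝓑 using (Similar; Els; near; ∅; mor; X; Y; Z; W; ι; p; peg; pe; e; g; eg; q; egq; gq; a)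
  module 𝔸 = Gadgets 𝓐
  module 𝔹 = Gadgets 𝓑

  Reply : 𝔸.El → I → J → Set
  Reply x i j = ∃ λ y → Els (extend i α) (extend j β) x y

  -- An element involves at most one chain element, so a move in the structure reduces to a move in
  -- the chain. The default `i₀` lengthens the tuple when none is involved.
  reply-any : I → (x : 𝔸.El) → ∃ λ i → ∀ j → Reply x i j
  reply-any i₀ 𝔸.∅               = i₀ , λ j → 𝔹.∅ , ∅
  reply-any i₀ (𝔸.mor (𝔸.ι {𝔸.X})) = i₀ , λ j → 𝔹.mor (𝔹.ι {𝔹.X}) , mor (ι X)
  reply-any i₀ (𝔸.mor (𝔸.ι {𝔸.Y})) = i₀ , λ j → 𝔹.mor (𝔹.ι {𝔹.Y}) , mor (ι Y)
  reply-any i₀ (𝔸.mor (𝔸.ι {𝔸.Z i})) = i , λ j → 𝔹.mor (𝔹.ι {𝔹.Z j}) , mor (ι (Z (near zero z≤n)))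
  reply-any i₀ (𝔸.mor (𝔸.ι {𝔸.W i})) = i , λ j → 𝔹.mor (𝔹.ι {𝔹.W j}) , mor (ι (W (near zero z≤n)))
  reply-any i₀ (𝔸.mor (𝔸.p i))   = i , λ j → 𝔹.mor (𝔹.p j) , mor (p (near zero z≤n))
  reply-any i₀ (𝔸.mor (𝔸.peg i)) = i , λ j → 𝔹.mor (𝔹.peg j) , mor (peg (near zero z≤n))
  reply-any i₀ (𝔸.mor (𝔸.pe i))  = i , λ j → 𝔹.mor (𝔹.pe j) , mor (pe (near zero z≤n))
  reply-any i₀ (𝔸.mor (𝔸.e i))   = i , λ j → 𝔹.mor (𝔹.e j) , mor (e (near zero z≤n))
  reply-any i₀ (𝔸.mor (𝔸.g i))   = i , λ j → 𝔹.mor (𝔹.g j) , mor (g (near zero z≤n))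
  reply-any i₀ (𝔸.mor (𝔸.eg i))  = i , λ j → 𝔹.mor (𝔹.eg j) , mor (eg (near zero z≤n))
  reply-any i₀ (𝔸.mor (𝔸.q i))   = i , λ j → 𝔹.mor (𝔹.q j) , mor (q (near zero z≤n))
  reply-any i₀ (𝔸.mor (𝔸.egq i)) = i , λ j → 𝔹.mor (𝔹.egq j) , mor (egq (near zero z≤n))
  reply-any i₀ (𝔸.mor (𝔸.gq i))  = i , λ j → 𝔹.mor (𝔹.gq j) , mor (gq (near zero z≤n))
  reply-any i₀ (𝔸.mor (𝔸.a i))   = i , λ j → 𝔹.mor (𝔹.a j) , mor (a (near zero z≤n))

  module _ {M} (aperiodic : Aperiodic M) (aperiodic′ : Chain.Aperiodic 𝓑 M)
           (sim : Similar α β (M + M)) where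

    Consistent : I → J → Set
    Consistent i j = ∀ k {s t} → s ≤ M → t ≤ M →
                     (fold i S s ≡ fold (α k) S t) ⇔ (fold j S′ s ≡ fold (β k) S′ t)

    -- Aperiodicity enters when the new element is compared with itself: on either side equality
    -- then forces `s` and `t` to agree.
    consistent⇒similar : ∀ {i j} → Consistent i j → Similar (extend i α) (extend j β) M
    consistent⇒similar {i} {j} new zero zero s≤M t≤M = mk⇔
      (λ h → cong (fold j S′) (orbit-injective aperiodic i s≤M t≤M h))
      (λ h → cong (fold i S) (orbit-injective′ aperiodic′ j s≤M t≤M h))
    consistent⇒similar new zero    (suc l) s≤M t≤M = new l s≤M t≤M
    consistent⇒similar new (suc k) zero    s≤M t≤M =
      mk⇔ (sym ∘ to (new k t≤M s≤M) ∘ sym) (sym ∘ from (new k t≤M s≤M) ∘ sym)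
    consistent⇒similar new (suc k) (suc l) s≤M t≤M =
      sim k l (ℕ.≤-trans s≤M (ℕ.m≤m+n M M)) (ℕ.≤-trans t≤M (ℕ.m≤m+n M M))

    -- An element within M steps of some α l is answered at the same offset from β l, which
    -- doubles the distances consulted; any other element is answered far from all of β.
    consistent : ∀ i → ∃ λ j → Consistent i j
    consistent i with Fin.any? (λ k → Fin.any? {n = suc M} λ s → Fin.any? {n = suc M} λ t →
                        fold i S (toℕ s) ≟ fold (α k) S (toℕ t))
    ... | yes (l , s , t , eq) =
      let j , eq′ = S′^-surj (toℕ s) (fold (β l) S′ (toℕ t)) in
      j , λ k {u} {v} u≤M v≤M →
        ⇔-trans (shift-⇔ {s = toℕ s} {toℕ t} u v eq)
          (⇔-trans (sim l k (ℕ.+-mono-≤ u≤M (Fin.toℕ≤pred[n] t)) (ℕ.+-mono-≤ (Fin.toℕ≤pred[n] s) v≤M))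
            (⇔-sym (shift-⇔′ {s = toℕ s} {toℕ t} u v eq′)))
    ... | no far = let j , far′ = fresh′ M β in
      j , λ k u≤M v≤M → mk⇔
        (λ h → contradiction (k , fromℕ< (s≤s u≤M) , fromℕ< (s≤s v≤M) ,
          (trans (cong (fold i S) (Fin.toℕ-fromℕ< (s≤s u≤M)))
            (trans h (sym (cong (fold (α k) S) (Fin.toℕ-fromℕ< (s≤s v≤M))))))) far)
        (λ h → contradiction h (far′ k u≤M v≤M))

    reply : (x : 𝔸.El) → ∃ λ i → ∃ λ j → Similar (extend i α) (extend j β) M × Reply x i j
    reply x = let i , r = reply-any (proj₁ (fresh 0 α)) x
                  j , c = consistent i
              in i , j , consistent⇒similar c , r j

-- Transfer of formulas between indistinguishable structures.

threshold : ∀ {n} → Formula n → ℕ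
-- The index of an arrow `a i` may lie one step beyond the tuple.
threshold (t ≈̂ u) = 1
threshold ⊥̂       = 1
threshold (¬̂ φ)   = threshold φ
threshold (φ ∧̂ ψ) = threshold φ + threshold ψ
threshold (φ ∨̂ ψ) = threshold φ + threshold ψ
threshold (φ ⇒̂ ψ) = threshold φ + threshold ψ
-- Each quantifier is a move, and a move halves the distance.
threshold (∀̂ φ)   = threshold φ + threshold φ
threshold (∃̂ φ)   = threshold φ + threshold φ

module Terms (𝓐 𝓑 : Chain) {m : ℕ} (α : Fin m → Chain.I 𝓐) (β : Fin m → Chain.I 𝓑)
  (sim : Position.Similar 𝓐 𝓑 α β 1) where
  open Position 𝓐 𝓑 α β
  module Fun = Functional sim
  module Inj = Position.Functional 𝓑 𝓐 β α (Flip.Similar-flip 𝓐 𝓑 α β sim)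
  open Flip 𝓐 𝓑 α β using (Objs-flip; Els-flip)

  Els-≡ : ∀ {x x′ y y′} → Els x x′ → Els y y′ → x ≡ y → x′ ≡ y′
  Els-≡ r s refl = Fun.Els-functional r s

  -- Related arrows are composable on both sides or on neither: functionality of `Objs` and of its
  -- flip excludes the mixed cases.
  Els-paste : ∀ {A B C E A′ B′ C′ E′}
              {f : 𝔸.Hom A B} {f′ : 𝔹.Hom A′ B′} {h : 𝔸.Hom C E} {h′ : 𝔹.Hom C′ E′}
              (B≟C : Dec (B ≡ C)) (B′≟C′ : Dec (B′ ≡ C′)) → Homs f f′ → Homs h h′ →
              Els (𝔸.paste B≟C f h) (𝔹.paste B′≟C′ f′ h′)
  Els-paste (yes refl) (yes refl)  r s = mor (Homs-⨾ r s)
  Els-paste (yes refl) (no B′≢C′)  r s =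
    contradiction (Fun.Objs-functional (Objs-target r) (Objs-source s)) B′≢C′
  Els-paste (no B≢C)   (yes refl)  r s =
    contradiction (Inj.Objs-functional (Objs-flip (Objs-target r)) (Objs-flip (Objs-source s))) B≢C
  Els-paste (no _)     (no _)      r s = ∅

  Els-· : ∀ {x x′ y y′} → Els x x′ → Els y y′ → Els (x 𝔸.· y) (x′ 𝔹.· y′)
  Els-· ∅       _       = ∅
  Els-· (mor _) ∅       = ∅
  Els-· (mor {_} {B} {_} {B′} r) (mor {C} {_} {C′} s) = Els-paste (B 𝔸.≟ₒ C) (B′ 𝔹.≟ₒ C′) r s

  Els-dm : ∀ {x x′} → Els x x′ → Els (𝔸.dm x) (𝔹.dm x′)
  Els-dm ∅       = ∅
  Els-dm (mor r) = mor (ι (Objs-source r))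

  Els-rn : ∀ {x x′} → Els x x′ → Els (𝔸.rn x) (𝔹.rn x′)
  Els-rn ∅       = ∅
  Els-rn (mor r) = mor (ι (Objs-target r))

  Els-term : ∀ {n} (t : Term n) {ρ σ} → (∀ k → Els (ρ k) (σ k)) →
             Els (⟦_⟧ₜ 𝔸.algebra t ρ) (⟦_⟧ₜ 𝔹.algebra t σ)
  Els-term (var k)  env = env k
  Els-term (D̂ t)    env = Els-dm (Els-term t env)
  Els-term (R̂ t)    env = Els-rn (Els-term t env)
  Els-term (t *̂ u)  env = Els-· (Els-term t env) (Els-term u env)

record Indistinguishable (𝓐 𝓑 : Chain) (M m : ℕ) {n : ℕ}
  (ρ : Fin n → Gadgets.El 𝓐) (σ : Fin n → Gadgets.El 𝓑) : Set where
  constructor indist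
  field
    aperiodicˡ : Chain.Aperiodic 𝓐 M
    aperiodicʳ : Chain.Aperiodic 𝓑 M
    α          : Fin m → Chain.I 𝓐
    β          : Fin m → Chain.I 𝓑
    similar    : Position.Similar 𝓐 𝓑 α β M
    related    : ∀ k → Position.Els 𝓐 𝓑 α β (ρ k) (σ k)

indist-mono : ∀ {𝓐 𝓑 M N m n} {ρ : Fin n → Gadgets.El 𝓐} {σ : Fin n → Gadgets.El 𝓑} → M ≤ N →
              Indistinguishable 𝓐 𝓑 N m ρ σ → Indistinguishable 𝓐 𝓑 M m ρ σ
indist-mono M≤N (indist apˡ apʳ α β sim env) =
  indist (λ i t≤M → apˡ i (ℕ.≤-trans t≤M M≤N)) (λ j t≤M → apʳ j (ℕ.≤-trans t≤M M≤N)) α β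
    (λ k l s≤M t≤M → sim k l (ℕ.≤-trans s≤M M≤N) (ℕ.≤-trans t≤M M≤N)) env

indist-sym : ∀ {𝓐 𝓑 M m n} {ρ : Fin n → Gadgets.El 𝓐} {σ : Fin n → Gadgets.El 𝓑} →
             Indistinguishable 𝓐 𝓑 M m ρ σ → Indistinguishable 𝓑 𝓐 M m σ ρ
indist-sym {𝓐} {𝓑} (indist apˡ apʳ α β sim env) =
  indist apʳ apˡ β α (F.Similar-flip sim) (λ k → F.Els-flip (env k))
  where module F = Flip 𝓐 𝓑 α β

forth : ∀ {𝓐 𝓑 M m n} {ρ : Fin n → Gadgets.El 𝓐} {σ : Fin n → Gadgets.El 𝓑} →
        Indistinguishable 𝓐 𝓑 (M + M) m ρ σ → ∀ x →
        ∃ λ y → Indistinguishable 𝓐 𝓑 M (suc m) (extend x ρ) (extend y σ)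
-- The weakened position supplies aperiodicity at `M`, whereas `similar` is taken from `pos`, at
-- `M + M`.
forth {𝓐} {𝓑} {M} pos x with indist-mono (ℕ.m≤m+n M M) pos
... | indist apˡ apʳ _ _ _ _ =
  let open Indistinguishable pos
      i , j , sim , y , r = Moves.reply 𝓐 𝓑 α β apˡ apʳ similar x
  in y , indist apˡ apʳ (extend i α) (extend j β) sim
       λ { zero → r ; (suc k) → Extension.Els-extend 𝓐 𝓑 α β i j (related k) }

-- One direction suffices because positions are symmetric: negations and premises flip the position,
-- and for `∀̂` the move is made on the second side and answered on the first.
transfer : ∀ {𝓐 𝓑 m n} (φ : Formula n) {ρ : Fin n → Gadgets.El 𝓐} {σ : Fin n → Gadgets.El 𝓑} →
           Indistinguishable 𝓐 𝓑 (threshold φ) m ρ σ →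
           Sat (Gadgets.algebra 𝓐) φ ρ → Sat (Gadgets.algebra 𝓑) φ σ
transfer {𝓐} {𝓑} (t ≈̂ u) (indist _ _ α β sim env) = Els-≡ (Els-term t env) (Els-term u env)
  where open Terms 𝓐 𝓑 α β sim
transfer ⊥̂       pos s = s
transfer (¬̂ φ)   pos s = s ∘ transfer φ (indist-sym pos)
transfer (φ ∧̂ ψ) pos (s , t) =
  transfer φ (indist-mono (ℕ.m≤m+n _ _) pos) s , transfer ψ (indist-mono (ℕ.m≤n+m _ _) pos) t
transfer (φ ∨̂ ψ) pos (inj₁ s) = inj₁ (transfer φ (indist-mono (ℕ.m≤m+n _ _) pos) s)
transfer (φ ∨̂ ψ) pos (inj₂ t) = inj₂ (transfer ψ (indist-mono (ℕ.m≤n+m _ _) pos) t)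
transfer (φ ⇒̂ ψ) pos s =
  transfer ψ (indist-mono (ℕ.m≤n+m _ _) pos) ∘ s ∘
  transfer φ (indist-sym (indist-mono (ℕ.m≤m+n _ _) pos))
transfer (∀̂ φ)   pos s y =
  let x , pos′ = forth (indist-sym pos) y in transfer φ (indist-sym pos′) (s x)
transfer (∃̂ φ)   pos (x , s) =
  let y , pos′ = forth pos x in y , transfer φ pos′ s

-- Transfer of finite theories, and the conclusion.

thresholds : List Sentence → ℕ
thresholds []      = 0
thresholds (φ ∷ T) = threshold φ + thresholds T

transfer-theory : ∀ {𝓐 𝓑} T → Chain.Aperiodic 𝓐 (thresholds T) → Chain.Aperiodic 𝓑 (thresholds T) →
                  ModelOf (Gadgets.algebra 𝓐) T → ModelOf (Gadgets.algebra 𝓑) T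
transfer-theory []      apˡ apʳ []      = []
transfer-theory (φ ∷ T) apˡ apʳ (s ∷ ss) =
  -- The game starts from empty tuples, which are similar up to any distance.
  transfer {m = 0} φ (indist-mono (ℕ.m≤m+n _ _) (indist apˡ apʳ (λ ()) (λ ()) (λ ()) λ ())) s ∷
  transfer-theory T (λ i t≤ → apˡ i (ℕ.≤-trans t≤ (ℕ.m≤n+m _ _)))
                    (λ j t≤ → apʳ j (ℕ.≤-trans t≤ (ℕ.m≤n+m _ _))) ss

-- These cycles have length `suc (suc n′)`, at least 2, so a single step cannot return to its start.
cycles-not-representable : ∀ n′ → ¬ Representable (Gadgets.algebra (Cycles.chain (suc n′)))
cycles-not-representable n′ rep with step^-aperiodic {1} (s≤s (s≤s z≤n)) i
    (Gadgets.Cyclic.cycle-trivial chain rep (suc n′) i (step^n i))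
  where
  open Cycles (suc n′)
  i : ℕ × Fin n
  i = 0 , zero
... | ()

theorem1 : ¬ (∃ λ (T : List Sentence) → Axiomatises T)
theorem1 (T , axiomatises) =
  -- Cycles of length `suc (suc M)` are aperiodic up to the threshold, and nontrivial even when `M`
  -- is 0.
  cycles-not-representable M (proj₂ (axiomatises _) (transfer-theory T
    (Integers.aperiodic M) (λ i t≤M → Cycles.aperiodic (suc M) i (ℕ.m≤n⇒m≤1+n t≤M))
    (proj₁ (axiomatises _) Integers.representable)))
  where
  M : ℕ
  M = thresholds T
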